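{- Let $f:\subseteq\mathcal C(\subseteq\mathbb N^{\mathbb N},\mathbb N^{\mathbb N})\times\mathbb N^{\mathbb N}\to\mathbb N^{\mathbb N}$ be a computable (partial) function. Then there is a total computable injection $R:\mathbb N^{\mathbb N}\to\mathbb N^{\mathbb N}$ such that \[\mathsf U_{R(q)}(p)=f(R,\langle q,p\rangle)\] for all $q,p\in\mathbb N^{\mathbb N}$ such that $f(R,\langle q,p\rangle)$ is defined.
   Context: A partial function $F:\subseteq\mathbb N^{\mathbb N}\to\mathbb N^{\mathbb N}$ is computable if there is a computable monotone (w.r.t. the prefix order) word function $\varphi:\mathbb N^*\to\mathbb N^*$ with $F(p)=\sup_{w\sqsubseteq p}\varphi(w)$ for all $p\in\mathrm{dom}(F)$; $F$ is continuous iff the same holds with an arbitrary monotone $\varphi$. $\mathcal C(\subseteq\mathbb N^{\mathbb N},\mathbb N^{\mathbb N})$ is the set of partial continuous functions $\subseteq\mathbb N^{\mathbb N}\to\mathbb N^{\mathbb N}$ (with natural domains) that is represented by a fixed standard total representation $\Phi$, where a name $q\in\mathbb N^{\mathbb N}$ encodes the graph of a monotone word function approximating $\Phi_q$. Write $\mathsf U_q:=\Phi_q$. With $\langle q,p\rangle:=q(0)p(0)q(1)p(1)\dots$, the universal function $\mathsf U\langle q,p\rangle:=\mathsf U_q(p)$ is a computable partial function, and the smn-theorem holds: for every computable (continuous) $F:\subseteq\mathbb N^{\mathbb N}\to\mathbb N^{\mathbb N}$ there is a total computable (continuous) $S:\mathbb N^{\mathbb N}\to\mathbb N^{\mathbb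 N}$ with $\mathsf U_{S(q)}(p)=F\langle q,p\rangle$ for all $\langle q,p\rangle\in\mathrm{dom}(F)$. Without loss of generality the names allow the digits $0,1,2$ as dummy symbols: adding or removing these digits in a name $q$ does not change $\mathsf U_q$. Computability of $f$ is understood with respect to the representation $\Phi$: there is a computable $F:\subseteq\mathbb N^{\mathbb N}\to\mathbb N^{\mathbb N}$ with $F\langle s,r\rangle=f(\mathsf U_s,r)$ for all $s,r\in\mathbb N^{\mathbb N}$ with $(\mathsf U_s,r)\in\mathrm{dom}(f)$. A function $F:\subseteq\mathbb N^{\mathbb N}\to\mathbb N^{\mathbb N}$ is a computable injection if it is computable and injective and there is a computable $G:\subseteq\mathbb N^{\mathbb N}\to\mathbb N^{\mathbb N}$ with $G\circ F(p)=p$ for all $p\in\mathrm{dom}(F)$. -}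

module Defs where

open import Data.Nat using (ℕ; zero; suc; _+_; _*_; _^_; _≤_; _<_; s≤s)
open import Data.Fin using (Fin)
open import Data.List using (List; []; _∷_; length; applyUpTo)
open import Data.List.Properties using (∷-injectiveˡ; ∷-injectiveʳ)
open import Data.List.Relation.Binary.Prefix.Heterogeneous using (Prefix)
open import Data.Vec as Vec using (Vec; []; _∷_)
open import Data.Vec.Relation.Binary.Pointwise.Inductive using (Pointwise)
open import Data.Product using (Σ-syntax; ∃-syntax; _×_; _,_)
open import Function using (_∘_; Func; _⇔_)
open import Level using (0ℓ; _⊔_) renaming (suc to lsuc)
open import Relation.Binary.Bundles using (Setoid)
open import Relation.Binary.PropositionalEquality
  using (_≡_; _≗_; refl; sym; trans; cong₂; _→-setoid_)

data Rec : ℕ → Set where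
  zeroᴿ : Rec 0
  sucᴿ  : Rec 1
  proj  : ∀ {n} → Fin n → Rec n
  comp  : ∀ {m n} → Rec m → Vec (Rec n) m → Rec n
  prec  : ∀ {n} → Rec n → Rec (2 + n) → Rec (1 + n)
  μ     : ∀ {n} → Rec (1 + n) → Rec n

infix 4 _[_]⇓_

data _[_]⇓_ : ∀ {n} → Rec n → Vec ℕ n → ℕ → Set where
  ⇓-zero : zeroᴿ [ [] ]⇓ 0
  ⇓-suc  : ∀ {x} → sucᴿ [ x ∷ [] ]⇓ suc x
  ⇓-proj : ∀ {n} {i : Fin n} {xs} → proj i [ xs ]⇓ Vec.lookup xs i
  ⇓-comp : ∀ {m n} {f : Rec m} {gs : Vec (Rec n) m} {xs ys z} →
           Pointwise (λ g y → g [ xs ]⇓ y) gs ys → f [ ys ]⇓ z →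
           comp f gs [ xs ]⇓ z
  ⇓-prec-zero : ∀ {n} {f : Rec n} {g xs z} →
           f [ xs ]⇓ z → prec f g [ 0 ∷ xs ]⇓ z
  ⇓-prec-suc : ∀ {n} {f : Rec n} {g xs k y z} →
           prec f g [ k ∷ xs ]⇓ y → g [ k ∷ y ∷ xs ]⇓ z →
           prec f g [ suc k ∷ xs ]⇓ z
  ⇓-μ    : ∀ {n} {f : Rec (1 + n)} {xs k} →
           (∀ j → j < k → ∃[ y ] f [ j ∷ xs ]⇓ suc y) → f [ k ∷ xs ]⇓ 0 →
           μ f [ xs ]⇓ k

Word : Set
Word = List ℕ

infix 4 _⊑_

_⊑_ : Word → Word → Set
_⊑_ = Prefix _≡_

-- pair is a bijection from ℕ × ℕ onto the positive integers, hence code is a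
-- bijection from Word onto ℕ.
pair : ℕ → ℕ → ℕ
pair m n = 2 ^ m * (1 + 2 * n)

code : Word → ℕ
code []      = 0
code (a ∷ w) = pair a (code w)

Monotone : (Word → Word) → Set
Monotone φ = ∀ {u w} → u ⊑ w → φ u ⊑ φ w

ComputableWord : (Word → Word) → Set
ComputableWord φ = Σ[ e ∈ Rec 1 ] (∀ w → e [ code w ∷ [] ]⇓ code (φ w))

-- Without function extensionality, points are compared by _≗_.
Baire : Setoid 0ℓ 0ℓ
Baire = ℕ →-setoid ℕ

𝔹 : Set
𝔹 = ℕ → ℕ

-- q 0 , p 0 , q 1 , p 1 , …
⟨_,_⟩ : 𝔹 → 𝔹 → 𝔹
⟨ q , p ⟩ zero    = q 0
⟨ q , p ⟩ (suc n) = ⟨ p , q ∘ suc ⟩ n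

infix 4 _⊏_

_⊏_ : Word → 𝔹 → Set
w ⊏ p = applyUpTo p (length w) ≡ w

-- The infinite sequence r is the supremum of V with respect to the prefix order
-- on finite and infinite sequences: r is an upper bound, and V has words of
-- unbounded length.
IsSup : (Word → Set) → 𝔹 → Set
IsSup V r = (∀ v → V v → v ⊏ r) × (∀ n → ∃[ v ] V v × n ≤ length v)

applyUpTo-agree : ∀ n {p r : 𝔹} → applyUpTo p n ≡ applyUpTo r n →
                  ∀ i → i < n → p i ≡ r i
applyUpTo-agree (suc n) eq zero    _         = ∷-injectiveˡ eq
applyUpTo-agree (suc n) eq (suc i) (s≤s i<n) =
  applyUpTo-agree n (∷-injectiveʳ eq) i i<n

applyUpTo-cong : ∀ n {p r : 𝔹} → p ≗ r → applyUpTo p n ≡ applyUpTo r n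
applyUpTo-cong zero    p≗r = refl
applyUpTo-cong (suc n) p≗r = cong₂ _∷_ (p≗r 0) (applyUpTo-cong n (p≗r ∘ suc))

⊏-resp : ∀ {w p r} → p ≗ r → w ⊏ p → w ⊏ r
⊏-resp {w} p≗r w⊏p = trans (sym (applyUpTo-cong (length w) p≗r)) w⊏p

IsSup-unique : ∀ {V r r′} → IsSup V r → IsSup V r′ → r ≗ r′
IsSup-unique (ub , long) (ub′ , _) n with long (suc n)
... | v , Vv , n<∣v∣ =
  applyUpTo-agree (length v) (trans (ub v Vv) (sym (ub′ v Vv))) n n<∣v∣

IsSup-resp : ∀ {V V′ : Word → Set} {r r′} →
             (∀ {v} → V v → V′ v) → (∀ {v} → V′ v → V v) →
             r ≗ r′ → IsSup V r → IsSup V′ r′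
IsSup-resp to from r≗r′ (ub , long) =
  (λ v V′v → ⊏-resp r≗r′ (ub v (from V′v))) ,
  (λ n → let v , Vv , n≤ = long n in v , to Vv , n≤)

-- A partial function is a single-valued relation respecting _≗_; F ∋ p ↦ r says
-- that F p is defined with value r.
record PFun : Set₁ where
  field
    _↦_        : 𝔹 → 𝔹 → Set
    functional : ∀ {p r r′} → p ↦ r → p ↦ r′ → r ≗ r′
    resp       : ∀ {p p′ r r′} → p ≗ p′ → r ≗ r′ → p ↦ r → p′ ↦ r′

infix 4 _∋_↦_

_∋_↦_ : PFun → 𝔹 → 𝔹 → Set
F ∋ p ↦ r = PFun._↦_ F p r

infix 4 _≐_

_≐_ : PFun → PFun → Set
F ≐ G = ∀ p r → F ∋ p ↦ r ⇔ G ∋ p ↦ r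

total : Func Baire Baire → PFun
total R = record
  { _↦_        = λ p r → to p ≗ r
  ; functional = λ e e′ i → trans (sym (e i)) (e′ i)
  ; resp       = λ p≗p′ r≗r′ e i →
                   trans (sym (to-cong p≗p′ i)) (trans (e i) (r≗r′ i))
  }
  where
    open Func R using (to) renaming (cong to to-cong)

Image : (Word → Word) → 𝔹 → Word → Set
Image φ p v = ∃[ w ] w ⊏ p × v ≡ φ w

Computable : PFun → Set
Computable F = Σ[ φ ∈ (Word → Word) ]
  Monotone φ × ComputableWord φ × (∀ p r → F ∋ p ↦ r → IsSup (Image φ p) r)

-- Membership in 𝒞(⊆ ℕ^ℕ, ℕ^ℕ).  The domain is natural: it consists of all p at
-- which the approximating word function has an infinite supremum.
In𝒞 : PFun → Set
In𝒞 F = Σ[ φ ∈ (Word → Word) ]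
  Monotone φ × (∀ p r → F ∋ p ↦ r ⇔ IsSup (Image φ p) r)

record IsComputableInjection (F : PFun) : Set₁ where
  field
    computable : Computable F
    injective  : ∀ {p p′ r} → F ∋ p ↦ r → F ∋ p′ ↦ r → p ≗ p′
    inverse    : Σ[ G ∈ PFun ] Computable G × (∀ {p r} → F ∋ p ↦ r → G ∋ r ↦ p)

-- Every digit other than 0, 1, 2 is of this form for exactly one (u , v).
entry : Word → Word → ℕ
entry u v = 2 + pair (code u) (code v)

-- q lists pairs (u , v), read as "inputs extending u have outputs extending v".
-- The digits 0, 1, 2 list nothing.
Listed : 𝔹 → 𝔹 → Word → Set
Listed q p v = ∃[ u ] u ⊏ p × ∃[ i ] q i ≡ entry u v

-- If q lists the graph of a monotone φ, then U q p is the supremum of Image φ p.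
-- Every q is a name: p is outside the domain of U q when the words listed for p are
-- inconsistent or of bounded length.
U : 𝔹 → PFun
U q = record
  { _↦_        = λ p r → IsSup (Listed q p) r
  ; functional = IsSup-unique
  ; resp       = λ p≗p′ → IsSup-resp
                   (λ (u , u⊏p , l) → u , ⊏-resp p≗p′ u⊏p , l)
                   (λ (u , u⊏p , l) → u , ⊏-resp (sym ∘ p≗p′) u⊏p , l)
  }

record PFunctional ℓ : Set (lsuc 0ℓ ⊔ lsuc ℓ) where
  field
    _∣_↦_      : PFun → 𝔹 → 𝔹 → Set ℓ
    domain     : ∀ {g r y} → g ∣ r ↦ y → In𝒞 g
    functional : ∀ {g r y y′} → g ∣ r ↦ y → g ∣ r ↦ y′ → y ≗ y′
    resp       : ∀ {g g′ r r′ y y′} → g ≐ g′ → r ≗ r′ → y ≗ y′ →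
                 g ∣ r ↦ y → g′ ∣ r′ ↦ y′

infix 4 _∋_∣_↦_

_∋_∣_↦_ : ∀ {ℓ} → PFunctional ℓ → PFun → 𝔹 → 𝔹 → Set ℓ
f ∋ g ∣ r ↦ y = PFunctional._∣_↦_ f g r y

ComputableFunctional : ∀ {ℓ} → PFunctional ℓ → Set (lsuc 0ℓ ⊔ ℓ)
ComputableFunctional f = Σ[ F ∈ PFun ]
  Computable F × (∀ s r y → f ∋ U s ∣ r ↦ y → F ∋ ⟨ s , r ⟩ ↦ y)

{-# OPTIONS --safe #-}
module Submission where

-- Let φ approximate a realizer of f.  For every s, row s q is a name of
-- p ↦ f(U_s, ⟨q,p⟩): it lists, for each word u, the value of φ on the first |u|
-- values of ⟨s,⟨q,u⟩⟩.  It remains to find s that is itself a name of row s.  Such an s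
-- lists at position code u the first |u| values of row s on extensions of u, and these
-- depend only on the values of s below |u| ≤ code u.  Hence s is defined by
-- course-of-values recursion, and neither a universal machine nor the recursion theorem
-- for programs is needed.

open import Defs
open import Data.Fin using (Fin; _↑ʳ_) renaming (zero to 0F; suc to sucF)
open import Data.Fin.Patterns using (1F; 2F; 3F)
open import Data.List using ([]; _∷_; length; applyUpTo; applyDownFrom; drop)
open import Data.List.Properties using (length-applyUpTo; length-applyDownFrom)
open import Data.List.Relation.Binary.Prefix.Heterogeneous using ([]; _∷_)
open import Data.Nat hiding (parity)
open import Data.Nat.GeneralisedArithmetic using (fold)
open import Data.Nat.Properties
open import Data.Product using (Σ-syntax; ∃-syntax; _×_; _,_; proj₁; proj₂)
open import Data.Sum using (_⊎_; inj₁; inj₂)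
open import Data.Vec as Vec using (Vec; []; _∷_)
open import Data.Vec.Properties using (tabulate-∘; tabulate∘lookup; lookup-++ʳ; tabulate-cong)
open import Data.Vec.Relation.Binary.Pointwise.Inductive using (Pointwise; []; _∷_)
open import Function using (Func; _∘_; mk⇔)
open import Relation.Binary.PropositionalEquality
  using (_≡_; _≗_; refl; sym; trans; cong; cong₂; subst; module ≡-Reasoning)

-- Finite prefixes

nth : Word → 𝔹
nth []      _       = 0
nth (a ∷ w) zero    = a
nth (a ∷ w) (suc i) = nth w i

applyUpTo-cong-< : ∀ n {p r : 𝔹} → (∀ i → i < n → p i ≡ r i) →
                   applyUpTo p n ≡ applyUpTo r n
applyUpTo-cong-< zero    eq = refl
applyUpTo-cong-< (suc n) eq =
  cong₂ _∷_ (eq 0 z<s) (applyUpTo-cong-< n (λ i i<n → eq (suc i) (s<s i<n)))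

applyUpTo-⊏ : ∀ (p : 𝔹) n → applyUpTo p n ⊏ p
applyUpTo-⊏ p n = cong (applyUpTo p) (length-applyUpTo p n)

⊏-nth : ∀ w → w ⊏ nth w
⊏-nth []      = refl
⊏-nth (a ∷ w) = cong (a ∷_) (⊏-nth w)

⊏⇒nth≡ : ∀ {w p} → w ⊏ p → ∀ i → i < length w → nth w i ≡ p i
⊏⇒nth≡ {w} w⊏p = applyUpTo-agree (length w) (trans (⊏-nth w) (sym w⊏p))

⊑⇒⊏-nth : ∀ {u w} → u ⊑ w → u ⊏ nth w
⊑⇒⊏-nth []           = refl
⊑⇒⊏-nth (refl ∷ u⊑w) = cong (_ ∷_) (⊑⇒⊏-nth u⊑w)

⊑⇒length≤ : ∀ {u w : Word} → u ⊑ w → length u ≤ length w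
⊑⇒length≤ []          = z≤n
⊑⇒length≤ (_ ∷ u⊑w) = s≤s (⊑⇒length≤ u⊑w)

applyUpTo-mono-⊑ : ∀ (p : 𝔹) {m n} → m ≤ n → applyUpTo p m ⊑ applyUpTo p n
applyUpTo-mono-⊑ p z≤n       = []
applyUpTo-mono-⊑ p (s≤s m≤n) = refl ∷ applyUpTo-mono-⊑ (p ∘ suc) m≤n

nth-applyDownFrom : ∀ (s : 𝔹) n i → i < n → nth (applyDownFrom s n) (n ∸ suc i) ≡ s i
nth-applyDownFrom s (suc n) i (s≤s i≤n) with m≤n⇒m<n∨m≡n i≤n
... | inj₁ i<n  rewrite +-∸-assoc 1 i<n = nth-applyDownFrom s n i i<n
... | inj₂ refl rewrite n∸n≡0 n = refl

-- Word functions from moduli of continuity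

Unbounded : (ℕ → ℕ) → Set
Unbounded ℓ = ∀ n → ∃[ k ] n ≤ ℓ k

id-unbounded : Unbounded (λ n → n)
id-unbounded n = n , ≤-refl

-- The first ℓ k values of T q are determined by the first k values of q.
HasModulus : (ℕ → ℕ) → (𝔹 → 𝔹) → Set
HasModulus ℓ T = ∀ k {q q′} → (∀ i → i < k → q i ≡ q′ i) →
                 ∀ m → m < ℓ k → T q m ≡ T q′ m

-- `nth` pads `w` with zeros. Under `HasModulus ℓ T` the padding is harmless: the values kept are
-- determined by `w` alone.
truncate : (ℕ → ℕ) → (𝔹 → 𝔹) → Word → Word
truncate ℓ T w = applyUpTo (T (nth w)) (ℓ (length w))

module _ {ℓ T} (T-mod : HasModulus ℓ T) where

  truncate-⊏⇒≡ : ∀ {w p} → w ⊏ p → truncate ℓ T w ≡ applyUpTo (T p) (ℓ (length w))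
  truncate-⊏⇒≡ {w} w⊏p =
    applyUpTo-cong-< (ℓ (length w)) (T-mod (length w) (⊏⇒nth≡ w⊏p))

  truncate-⊏ : ∀ {w p} → w ⊏ p → truncate ℓ T w ⊏ T p
  truncate-⊏ {w} {p} w⊏p =
    subst (_⊏ T p) (sym (truncate-⊏⇒≡ w⊏p)) (applyUpTo-⊏ (T p) (ℓ (length w)))

  truncate-long : Unbounded ℓ → ∀ p n → ∃[ k ] n ≤ length (truncate ℓ T (applyUpTo p k))
  truncate-long unb p n with unb n
  ... | k , n≤ℓk = k , subst (n ≤_)
    (sym (trans (length-applyUpTo _ (ℓ (length (applyUpTo p k))))
                (cong ℓ (length-applyUpTo p k))))
    n≤ℓk

  -- Both words are prefixes of the single sequence `T (nth w)`.
  truncate-monotone : (∀ {m n} → m ≤ n → ℓ m ≤ ℓ n) → Monotone (truncate ℓ T)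
  truncate-monotone ℓ-mono {u} {w} u⊑w =
    subst (_⊑ truncate ℓ T w) (sym (truncate-⊏⇒≡ (⊑⇒⊏-nth u⊑w)))
      (applyUpTo-mono-⊑ (T (nth w)) (ℓ-mono (⊑⇒length≤ u⊑w)))

  truncate-sup : Unbounded ℓ → ∀ p → IsSup (Image (truncate ℓ T) p) (T p)
  truncate-sup unb p =
    (λ { v (w , w⊏p , refl) → truncate-⊏ w⊏p }) ,
    (λ n → let k , n≤ = truncate-long unb p n
           in _ , (applyUpTo p k , applyUpTo-⊏ p k , refl) , n≤)

total-computable : ∀ (R : Func Baire Baire) {ℓ} → HasModulus ℓ (Func.to R) →
                   (∀ {m n} → m ≤ n → ℓ m ≤ ℓ n) → Unbounded ℓ →
                   ComputableWord (truncate ℓ (Func.to R)) → Computable (total R)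
total-computable R {ℓ} R-mod ℓ-mono unb comp-R =
  truncate ℓ (Func.to R) , truncate-monotone R-mod ℓ-mono , comp-R ,
  λ p r Rp≗r → IsSup-resp (λ v → v) (λ v → v) Rp≗r (truncate-sup R-mod unb p)

-- Interleaving

parity : ℕ → ℕ
parity 0             = 0
parity 1             = 1
parity (suc (suc n)) = parity n

cond : ℕ → ℕ → ℕ → ℕ
cond zero    a b = a
cond (suc _) a b = b

-- Replaces the swapping recursion by a case distinction on parity, which can be programmed.
⟨⟩-cond : ∀ m {a b} → ⟨ a , b ⟩ m ≡ cond (parity m) (a ⌊ m /2⌋) (b ⌊ m /2⌋)
⟨⟩-cond 0             = refl
⟨⟩-cond 1             = refl
⟨⟩-cond (suc (suc m)) = ⟨⟩-cond m

⟨⟩-value : ∀ m {a b} → ⟨ a , b ⟩ m ≡ a ⌊ m /2⌋ ⊎ ⟨ a , b ⟩ m ≡ b ⌊ m /2⌋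
⟨⟩-value 0             = inj₁ refl
⟨⟩-value 1             = inj₂ refl
⟨⟩-value (suc (suc m)) = ⟨⟩-value m

-- Only index `⌊ m /2⌋` is read; the cruder bound `m` is preserved when pairs are nested.
⟨⟩-cong-≤ : ∀ m {a a′ b b′} → (∀ i → i ≤ m → a i ≡ a′ i) →
            (∀ i → i ≤ m → b i ≡ b′ i) → ⟨ a , b ⟩ m ≡ ⟨ a′ , b′ ⟩ m
⟨⟩-cong-≤ zero    a≡a′ b≡b′ = a≡a′ 0 z≤n
⟨⟩-cong-≤ (suc m) a≡a′ b≡b′ =
  ⟨⟩-cong-≤ m (λ i i≤m → b≡b′ i (m≤n⇒m≤1+n i≤m)) (λ i i≤m → a≡a′ (suc i) (s≤s i≤m))

2*suc : ∀ n → 2 * suc n ≡ 2 + 2 * n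
2*suc n = cong suc (+-suc n (n + 0))

⟨⟩-even : ∀ n {a b} → ⟨ a , b ⟩ (2 * n) ≡ a n
⟨⟩-even zero    = refl
⟨⟩-even (suc n) {a} {b} = trans (cong ⟨ a , b ⟩ (2*suc n)) (⟨⟩-even n)

⟨⟩-odd : ∀ n {a b} → ⟨ a , b ⟩ (1 + 2 * n) ≡ b n
⟨⟩-odd n {a} {b} = ⟨⟩-even n {b} {a ∘ suc}

parity-double : ∀ n → parity (2 * n) ≡ 0
parity-double zero    = refl
parity-double (suc n) = trans (cong parity (2*suc n)) (parity-double n)

parity-1+double : ∀ n → parity (1 + 2 * n) ≡ 1
parity-1+double zero    = refl
parity-1+double (suc n) = trans (cong (parity ∘ suc) (2*suc n)) (parity-1+double n)

half-double : ∀ n → ⌊ 2 * n /2⌋ ≡ n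
half-double zero    = refl
half-double (suc n) = trans (cong ⌊_/2⌋ (2*suc n)) (cong suc (half-double n))

half-1+double : ∀ n → ⌊ 1 + 2 * n /2⌋ ≡ n
half-1+double zero    = refl
half-1+double (suc n) = trans (cong (⌊_/2⌋ ∘ suc) (2*suc n)) (cong suc (half-1+double n))

<half⇒double< : ∀ n {m} → m < ⌊ n /2⌋ → 2 * m < n
<half⇒double< (suc (suc n)) {zero}  _        = z<s
<half⇒double< (suc (suc n)) {suc m} (s<s m<) =
  subst (_< suc (suc n)) (sym (2*suc m)) (s<s (s<s (<half⇒double< n m<)))

half-unbounded : Unbounded ⌊_/2⌋
half-unbounded n = 2 * n , ≤-reflexive (sym (half-double n))

-- Decoding numbers as words

sg : ℕ → ℕ
sg zero    = 0
sg (suc _) = 1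

-- Bounded search in disguise: in `hd` and `len` the nonzero values of `b` form an initial segment,
-- and their number is its length.
count : 𝔹 → ℕ → ℕ
count b zero    = 0
count b (suc k) = sg (b k) + count b k

sg≤1 : ∀ n → sg n ≤ 1
sg≤1 zero    = z≤n
sg≤1 (suc _) = ≤-refl

count≤ : ∀ b k → count b k ≤ k
count≤ b zero    = z≤n
count≤ b (suc k) = +-mono-≤ (sg≤1 (b k)) (count≤ b k)

sg-∸-⊓ : ∀ m k → sg (m ∸ k) + m ⊓ k ≡ m ⊓ suc k
sg-∸-⊓ zero    zero    = refl
sg-∸-⊓ zero    (suc k) = refl
sg-∸-⊓ (suc m) zero    = cong suc (sym (⊓-zeroʳ m))
sg-∸-⊓ (suc m) (suc k) = trans (+-suc (sg (m ∸ k)) (m ⊓ k)) (cong suc (sg-∸-⊓ m k))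

count-∸ : ∀ {b m} → (∀ j → sg (b j) ≡ sg (m ∸ j)) → ∀ k → count b k ≡ m ⊓ k
count-∸ {b} {m} eq zero    = sym (⊓-zeroʳ m)
count-∸ {b} {m} eq (suc k) =
  trans (cong₂ _+_ (eq k) (count-∸ eq k)) (sg-∸-⊓ m k)

-- Halves even numbers and fixes odd ones.
strip : ℕ → ℕ
strip c = ⌊ (1 + parity c) * c /2⌋

-- The exponent of 2 in a positive `c`: exactly that many iterates of `strip` are even. At 0 the
-- value is 0, the default of `nth`.
hd : ℕ → ℕ
hd c = count (λ j → 1 ∸ parity (fold c strip j)) c

-- For positive `c`, stripping `c` times leaves only the odd part 1 + 2n. Since `tl 0` is 0, tails
-- beyond the end of a word stay empty.
tl : ℕ → ℕ
tl c = ⌊ fold c strip c /2⌋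

at : ℕ → 𝔹
at c i = hd (fold c tl i)

-- Only the empty word has code 0, so the length is the number of nonzero iterated tails.
len : ℕ → ℕ
len c = count (fold c tl) c

len≤ : ∀ c → len c ≤ c
len≤ c = count≤ (fold c tl) c

pair-0 : ∀ n → pair 0 n ≡ 1 + 2 * n
pair-0 n = *-identityˡ (1 + 2 * n)

pair-suc : ∀ m n → pair (suc m) n ≡ 2 * pair m n
pair-suc m n = *-assoc 2 (2 ^ m) (1 + 2 * n)

parity-pair : ∀ m n → parity (pair m n) ≡ 1 ∸ m
parity-pair zero    n = trans (cong parity (pair-0 n)) (parity-1+double n)
parity-pair (suc m) n =
  trans (cong parity (pair-suc m n)) (trans (parity-double (pair m n)) (sym (0∸n≡0 m)))

strip-pair : ∀ m n → strip (pair m n) ≡ pair (pred m) n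
strip-pair zero n rewrite parity-pair zero n = half-double (pair 0 n)
strip-pair (suc m) n rewrite parity-pair (suc m) n | 0∸n≡0 m =
  trans (cong ⌊_/2⌋ (trans (*-identityˡ (pair (suc m) n)) (pair-suc m n)))
        (half-double (pair m n))

fold-strip-pair : ∀ m n j → fold (pair m n) strip j ≡ pair (m ∸ j) n
fold-strip-pair m n zero    = refl
fold-strip-pair m n (suc j) = begin
  strip (fold (pair m n) strip j) ≡⟨ cong strip (fold-strip-pair m n j) ⟩
  strip (pair (m ∸ j) n)          ≡⟨ strip-pair (m ∸ j) n ⟩
  pair (pred (m ∸ j)) n           ≡⟨ cong (λ k → pair k n) (pred[m∸n]≡m∸[1+n] m j) ⟩
  pair (m ∸ suc j) n              ∎
  where open ≡-Reasoning

n<2^n : ∀ n → n < 2 ^ n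
n<2^n zero    = ≤-refl
n<2^n (suc n) = +-mono-≤ (m^n>0 2 n) (≤-trans (n<2^n n) (m≤m+n (2 ^ n) 0))

-- Together with `pair-<ʳ`, this makes a code a sufficient bound for the iterations in `hd`, `tl`
-- and `len`.
pair-<ˡ : ∀ m n → m < pair m n
pair-<ˡ m n = <-≤-trans (n<2^n m) (m≤m*n (2 ^ m) (1 + 2 * n))

pair-<ʳ : ∀ m n → n < pair m n
pair-<ʳ m n = <-≤-trans (s≤s (m≤m+n n (n + 0)))
  (m≤n*m (1 + 2 * n) (2 ^ m) {{m^n≢0 2 m}})

hd-pair : ∀ m n → hd (pair m n) ≡ m
hd-pair m n = trans (count-∸ even? (pair m n)) (m≤n⇒m⊓n≡m (<⇒≤ (pair-<ˡ m n)))
  where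
    sg-1∸1∸ : ∀ k → sg (1 ∸ (1 ∸ k)) ≡ sg k
    sg-1∸1∸ zero    = refl
    sg-1∸1∸ (suc k) = cong (λ x → sg (1 ∸ x)) (0∸n≡0 k)

    even? : ∀ j → sg (1 ∸ parity (fold (pair m n) strip j)) ≡ sg (m ∸ j)
    even? j = trans
      (cong (λ x → sg (1 ∸ x))
        (trans (cong parity (fold-strip-pair m n j)) (parity-pair (m ∸ j) n)))
      (sg-1∸1∸ (m ∸ j))

tl-pair : ∀ m n → tl (pair m n) ≡ n
tl-pair m n = begin
  ⌊ fold (pair m n) strip (pair m n) /2⌋
    ≡⟨ cong ⌊_/2⌋ (fold-strip-pair m n (pair m n)) ⟩
  ⌊ pair (m ∸ pair m n) n /2⌋
    ≡⟨ cong (λ k → ⌊ pair k n /2⌋) (m≤n⇒m∸n≡0 (<⇒≤ (pair-<ˡ m n))) ⟩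
  ⌊ pair 0 n /2⌋
    ≡⟨ cong ⌊_/2⌋ (pair-0 n) ⟩
  ⌊ 1 + 2 * n /2⌋
    ≡⟨ half-1+double n ⟩
  n ∎
  where open ≡-Reasoning

pair-injective : ∀ {m n m′ n′} → pair m n ≡ pair m′ n′ → m ≡ m′ × n ≡ n′
pair-injective {m} {n} {m′} {n′} eq =
  trans (sym (hd-pair m n)) (trans (cong hd eq) (hd-pair m′ n′)) ,
  trans (sym (tl-pair m n)) (trans (cong tl eq) (tl-pair m′ n′))

code-injective : ∀ u v → code u ≡ code v → u ≡ v
code-injective []      []      eq = refl
code-injective []      (b ∷ v) eq with subst (code v <_) (sym eq) (pair-<ʳ b (code v))
... | ()
code-injective (a ∷ u) []      eq with subst (code u <_) eq (pair-<ʳ a (code u))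
... | ()
code-injective (a ∷ u) (b ∷ v) eq with pair-injective {a} {code u} {b} {code v} eq
... | a≡b , u≡v = cong₂ _∷_ a≡b (code-injective u v u≡v)

fold-tl-code : ∀ w j → fold (code w) tl j ≡ code (drop j w)
fold-tl-code w zero    = refl
fold-tl-code w (suc j) = trans (cong tl (fold-tl-code w j)) (tl-drop w j)
  where
    tl-drop : ∀ w j → tl (code (drop j w)) ≡ code (drop (suc j) w)
    tl-drop []      zero    = refl
    tl-drop []      (suc j) = refl
    tl-drop (a ∷ w) zero    = tl-pair a (code w)
    tl-drop (a ∷ w) (suc j) = tl-drop w j

at-code : ∀ w → at (code w) ≗ nth w
at-code w i = trans (cong hd (fold-tl-code w i)) (hd-drop w i)
  where
    hd-drop : ∀ w i → hd (code (drop i w)) ≡ nth w i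
    hd-drop []      zero    = refl
    hd-drop []      (suc i) = refl
    hd-drop (a ∷ w) zero    = hd-pair a (code w)
    hd-drop (a ∷ w) (suc i) = hd-drop w i

length≤code : ∀ w → length w ≤ code w
length≤code []      = z≤n
length≤code (a ∷ w) = ≤-<-trans (length≤code w) (pair-<ʳ a (code w))

len-code : ∀ w → len (code w) ≡ length w
len-code w = trans (count-∸ (λ j → trans (cong sg (fold-tl-code w j)) (sg-drop w j)) (code w))
                   (m≤n⇒m⊓n≡m (length≤code w))
  where
    sg-pair : ∀ m n → sg (pair m n) ≡ 1
    sg-pair m n with pair m n | pair-<ʳ m n
    ... | suc _ | _ = refl

    sg-drop : ∀ w j → sg (code (drop j w)) ≡ sg (length w ∸ j)
    sg-drop []      zero    = refl
    sg-drop []      (suc j) = refl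
    sg-drop (a ∷ w) zero    = sg-pair a (code w)
    sg-drop (a ∷ w) (suc j) = sg-drop w j

-- Recursive functions

-- Programs are built together with their meaning, so that computability reduces to equations
-- between functions.
record RecFun (n : ℕ) : Set where
  field
    ⟦_⟧     : Vec ℕ n → ℕ
    program : Rec n
    correct : ∀ xs → program [ xs ]⇓ ⟦_⟧ xs

open RecFun

infixr 9 _∘ᴿ_

_∘ᴿ_ : ∀ {m n} → RecFun m → Vec (RecFun n) m → RecFun n
f ∘ᴿ gs = record
  { ⟦_⟧     = λ xs → ⟦ f ⟧ (Vec.map (λ g → ⟦ g ⟧ xs) gs)
  ; program = comp (program f) (Vec.map program gs)
  ; correct = λ xs → ⇓-comp (arguments xs gs) (correct f _)
  }
  where
    arguments : ∀ {m n} xs (gs : Vec (RecFun n) m) →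
                Pointwise (λ g y → g [ xs ]⇓ y)
                  (Vec.map program gs) (Vec.map (λ g → ⟦ g ⟧ xs) gs)
    arguments xs []       = []
    arguments xs (g ∷ gs) = correct g xs ∷ arguments xs gs

-- Keeps the program and exchanges the meaning assembled by the combinators for the intended form.
graph≡ : ∀ {n} (h : Vec ℕ n → ℕ) (f : RecFun n) → (∀ xs → ⟦ f ⟧ xs ≡ h xs) → RecFun n
graph≡ h f f≗h = record
  { ⟦_⟧     = h
  ; program = program f
  ; correct = λ xs → subst (program f [ xs ]⇓_) (f≗h xs) (correct f xs)
  }

var : ∀ {n} → Fin n → RecFun n
var i = record { ⟦_⟧ = λ xs → Vec.lookup xs i ; program = proj i ; correct = λ _ → ⇓-proj }

zeroᶠ : ∀ {n} → RecFun n
zeroᶠ = record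
  { ⟦_⟧ = λ _ → 0 ; program = comp zeroᴿ [] ; correct = λ _ → ⇓-comp [] ⇓-zero }

sucᶠ : RecFun 1
sucᶠ = record
  { ⟦_⟧ = λ { (x ∷ []) → suc x } ; program = sucᴿ ; correct = λ { (x ∷ []) → ⇓-suc } }

primrec : ∀ {n} (h : Vec ℕ (1 + n) → ℕ) (f : RecFun n) (g : RecFun (2 + n)) →
          (∀ xs → ⟦ f ⟧ xs ≡ h (0 ∷ xs)) →
          (∀ k xs → ⟦ g ⟧ (k ∷ h (k ∷ xs) ∷ xs) ≡ h (suc k ∷ xs)) →
          RecFun (1 + n)
primrec h f g h-zero h-suc = record
  { ⟦_⟧     = h
  ; program = prec (program f) (program g)
  ; correct = λ { (k ∷ xs) → terminates k xs }
  }
  where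
    terminates : ∀ k xs → prec (program f) (program g) [ k ∷ xs ]⇓ h (k ∷ xs)
    terminates zero xs =
      ⇓-prec-zero (subst (program f [ xs ]⇓_) (h-zero xs) (correct f xs))
    terminates (suc k) xs =
      ⇓-prec-suc (terminates k xs) (subst (program g [ _ ]⇓_) (h-suc k xs) (correct g _))

params : ∀ k {n} → Vec (RecFun (k + n)) n
params k = Vec.tabulate (λ i → var (k ↑ʳ i))

-- For a variable arity the vector of projections does not reduce, so `refl` does not show that
-- parameters are passed on unchanged.
params-correct : ∀ {k n} (ys : Vec ℕ k) (xs : Vec ℕ n) →
                 Vec.map (λ g → ⟦ g ⟧ (ys Vec.++ xs)) (params k) ≡ xs
params-correct {k} ys xs = begin
  Vec.map (λ g → ⟦ g ⟧ (ys Vec.++ xs)) (params k)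
    ≡⟨ tabulate-∘ (λ g → ⟦ g ⟧ (ys Vec.++ xs)) (λ i → var (k ↑ʳ i)) ⟨
  Vec.tabulate (λ i → Vec.lookup (ys Vec.++ xs) (k ↑ʳ i))
    ≡⟨ tabulate-cong (lookup-++ʳ ys xs) ⟩
  Vec.tabulate (Vec.lookup xs)
    ≡⟨ tabulate∘lookup xs ⟩
  xs ∎
  where open ≡-Reasoning

oneᶠ twoᶠ : ∀ {n} → RecFun n
oneᶠ = sucᶠ ∘ᴿ (zeroᶠ ∷ [])
twoᶠ = sucᶠ ∘ᴿ (oneᶠ ∷ [])

addᶠ : RecFun 2
addᶠ = primrec (λ { (m ∷ n ∷ []) → m + n }) (var 0F) (sucᶠ ∘ᴿ (var 1F ∷ []))
  (λ { (_ ∷ []) → refl }) (λ { _ (_ ∷ []) → refl })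

mulᶠ : RecFun 2
mulᶠ = primrec (λ { (m ∷ n ∷ []) → m * n }) zeroᶠ (addᶠ ∘ᴿ (var 2F ∷ var 1F ∷ []))
  (λ { (_ ∷ []) → refl }) (λ { _ (_ ∷ []) → refl })

predᶠ : RecFun 1
predᶠ = primrec (λ { (n ∷ []) → pred n }) zeroᶠ (var 0F) (λ { [] → refl }) (λ { _ [] → refl })

-- Primitive recursion runs on the first argument, and truncated subtraction recurses on the
-- subtrahend.
flip-monusᶠ : RecFun 2
flip-monusᶠ = primrec (λ { (n ∷ m ∷ []) → m ∸ n }) (var 0F) (predᶠ ∘ᴿ (var 1F ∷ []))
  (λ { (_ ∷ []) → refl }) (λ { n (m ∷ []) → pred[m∸n]≡m∸[1+n] m n })

monusᶠ : RecFun 2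
monusᶠ = graph≡ (λ { (m ∷ n ∷ []) → m ∸ n }) (flip-monusᶠ ∘ᴿ (var 1F ∷ var 0F ∷ []))
  (λ { (_ ∷ _ ∷ []) → refl })

pow2ᶠ : RecFun 1
pow2ᶠ = primrec (λ { (n ∷ []) → 2 ^ n }) oneᶠ (mulᶠ ∘ᴿ (twoᶠ ∷ var 1F ∷ []))
  (λ { [] → refl }) (λ { _ [] → refl })

pairᶠ : RecFun 2
pairᶠ = graph≡ (λ { (m ∷ n ∷ []) → pair m n })
  (mulᶠ ∘ᴿ (pow2ᶠ ∘ᴿ (var 0F ∷ []) ∷ sucᶠ ∘ᴿ (mulᶠ ∘ᴿ (twoᶠ ∷ var 1F ∷ []) ∷ []) ∷ []))
  (λ { (_ ∷ _ ∷ []) → refl })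

sgᶠ : RecFun 1
sgᶠ = primrec (λ { (n ∷ []) → sg n }) zeroᶠ oneᶠ (λ { [] → refl }) (λ { _ [] → refl })

condᶠ : RecFun 3
condᶠ = primrec (λ { (n ∷ a ∷ b ∷ []) → cond n a b }) (var 0F) (var 3F)
  (λ { (_ ∷ _ ∷ []) → refl }) (λ { _ (_ ∷ _ ∷ []) → refl })

-- With `half-suc`, turns two-step recursions into the one-step recursions that `primrec` accepts.
parity-suc : ∀ n → 1 ∸ parity n ≡ parity (suc n)
parity-suc 0             = refl
parity-suc 1             = refl
parity-suc (suc (suc n)) = parity-suc n

half-suc : ∀ n → parity n + ⌊ n /2⌋ ≡ ⌊ suc n /2⌋
half-suc 0             = refl
half-suc 1             = refl
half-suc (suc (suc n)) = trans (+-suc (parity n) ⌊ n /2⌋) (cong suc (half-suc n))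

parityᶠ : RecFun 1
parityᶠ = primrec (λ { (n ∷ []) → parity n }) zeroᶠ (monusᶠ ∘ᴿ (oneᶠ ∷ var 1F ∷ []))
  (λ { [] → refl }) (λ { n [] → parity-suc n })

halfᶠ : RecFun 1
halfᶠ = primrec (λ { (n ∷ []) → ⌊ n /2⌋ }) zeroᶠ
  (addᶠ ∘ᴿ (parityᶠ ∘ᴿ (var 0F ∷ []) ∷ var 1F ∷ []))
  (λ { [] → refl }) (λ { n [] → half-suc n })

foldᶠ : RecFun 1 → RecFun 2
foldᶠ f = primrec (λ { (j ∷ c ∷ []) → fold c (λ x → ⟦ f ⟧ (x ∷ [])) j })
  (var 0F) (f ∘ᴿ (var 1F ∷ [])) (λ { (_ ∷ []) → refl }) (λ { _ (_ ∷ []) → refl })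

countᶠ : ∀ {n} → RecFun (1 + n) → RecFun (1 + n)
countᶠ b = primrec (λ { (k ∷ xs) → count (λ j → ⟦ b ⟧ (j ∷ xs)) k }) zeroᶠ
  (addᶠ ∘ᴿ (sgᶠ ∘ᴿ (b ∘ᴿ (var 0F ∷ params 2) ∷ []) ∷ var 1F ∷ []))
  (λ _ → refl)
  (λ k xs → cong (λ ys → sg (⟦ b ⟧ (k ∷ ys)) + count (λ j → ⟦ b ⟧ (j ∷ xs)) k)
                 (params-correct (k ∷ _ ∷ []) xs))

stripᶠ : RecFun 1
stripᶠ = graph≡ (λ { (c ∷ []) → strip c })
  (halfᶠ ∘ᴿ (mulᶠ ∘ᴿ (sucᶠ ∘ᴿ (parityᶠ ∘ᴿ (var 0F ∷ []) ∷ []) ∷ var 0F ∷ []) ∷ []))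
  (λ { (_ ∷ []) → refl })

hdᶠ : RecFun 1
hdᶠ = graph≡ (λ { (c ∷ []) → hd c })
  (countᶠ (monusᶠ ∘ᴿ (oneᶠ ∷ parityᶠ ∘ᴿ (foldᶠ stripᶠ ∷ []) ∷ [])) ∘ᴿ (var 0F ∷ var 0F ∷ []))
  (λ { (_ ∷ []) → refl })

tlᶠ : RecFun 1
tlᶠ = graph≡ (λ { (c ∷ []) → tl c })
  (halfᶠ ∘ᴿ (foldᶠ stripᶠ ∘ᴿ (var 0F ∷ var 0F ∷ []) ∷ [])) (λ { (_ ∷ []) → refl })

atᶠ : RecFun 2
atᶠ = graph≡ (λ { (c ∷ i ∷ []) → at c i }) (hdᶠ ∘ᴿ (foldᶠ tlᶠ ∘ᴿ (var 1F ∷ var 0F ∷ []) ∷ []))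
  (λ { (_ ∷ _ ∷ []) → refl })

lenᶠ : RecFun 1
lenᶠ = graph≡ (λ { (c ∷ []) → len c }) (countᶠ (foldᶠ tlᶠ) ∘ᴿ (var 0F ∷ var 0F ∷ []))
  (λ { (_ ∷ []) → refl })

-- A code grows only at the front of its word, so recursion on `k` collects the values of `g` below
-- `n` from the last one backwards.
lastValues : 𝔹 → ℕ → ℕ → Word
lastValues g n zero    = []
lastValues g n (suc k) = g (n ∸ suc k) ∷ lastValues g n k

lastValues-applyUpTo : ∀ g {n} k → k ≤ n → lastValues g n k ≡ applyUpTo (λ i → g (n ∸ k + i)) k
lastValues-applyUpTo g zero    _   = refl
lastValues-applyUpTo g {n} (suc k) k<n = cong₂ _∷_
  (cong g (sym (+-identityʳ (n ∸ suc k))))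
  (trans (lastValues-applyUpTo g k (<⇒≤ k<n)) (applyUpTo-cong k (cong g ∘ shift)))
  where
    shift : ∀ i → n ∸ k + i ≡ n ∸ suc k + suc i
    shift i = trans (cong (_+ i) (+-∸-assoc 1 k<n)) (sym (+-suc (n ∸ suc k) i))

lastValues-all : ∀ g n → lastValues g n n ≡ applyUpTo g n
lastValues-all g n = trans (lastValues-applyUpTo g n ≤-refl)
  (applyUpTo-cong n (λ i → cong (λ k → g (k + i)) (n∸n≡0 n)))

applyUpToᶠ : ∀ {n} → RecFun (1 + n) → RecFun (1 + n)
applyUpToᶠ {n} g = graph≡ (λ { (l ∷ xs) → code (applyUpTo (value xs) l) })
  (lastValuesᶠ ∘ᴿ (var 0F ∷ var 0F ∷ params 1))
  (λ { (l ∷ xs) → trans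
    (cong (λ ys → code (lastValues (value ys) l l)) (params-correct (l ∷ []) xs))
    (cong code (lastValues-all (value xs) l)) })
  where
    value : Vec ℕ n → 𝔹
    value xs i = ⟦ g ⟧ (i ∷ xs)

    lastValuesᶠ : RecFun (2 + n)
    lastValuesᶠ = primrec (λ { (k ∷ l ∷ xs) → code (lastValues (value xs) l k) }) zeroᶠ
      (pairᶠ ∘ᴿ (g ∘ᴿ (monusᶠ ∘ᴿ (var 2F ∷ sucᶠ ∘ᴿ (var 0F ∷ []) ∷ []) ∷ params 3) ∷ var 1F ∷ []))
      (λ { (_ ∷ _) → refl })
      (λ { k (l ∷ xs) → cong
        (λ ys → pair (value ys (l ∸ suc k)) (code (lastValues (value xs) l k)))
        (params-correct (k ∷ _ ∷ l ∷ []) xs) })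

interleaveᶠ : ∀ {n} → RecFun (1 + n) → RecFun (1 + n) → RecFun (1 + n)
interleaveᶠ {n} f g = graph≡
  (λ { (m ∷ xs) → ⟨ (λ i → ⟦ f ⟧ (i ∷ xs)) , (λ i → ⟦ g ⟧ (i ∷ xs)) ⟩ m })
  (condᶠ ∘ᴿ (parityᶠ ∘ᴿ (var 0F ∷ []) ∷ f ∘ᴿ half ∷ g ∘ᴿ half ∷ []))
  (λ { (m ∷ xs) → trans
    (cong (λ ys → cond (parity m) (⟦ f ⟧ (⌊ m /2⌋ ∷ ys)) (⟦ g ⟧ (⌊ m /2⌋ ∷ ys)))
          (params-correct (m ∷ []) xs))
    (sym (⟨⟩-cond m)) })
  where
    half : Vec (RecFun (1 + n)) (1 + n)
    half = halfᶠ ∘ᴿ (var 0F ∷ []) ∷ params 1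

-- Digits of a row and recovery of its parameter

digitᶠ : RecFun 2
digitᶠ = graph≡ (λ { (m ∷ n ∷ []) → 2 + pair m n })
  (sucᶠ ∘ᴿ (sucᶠ ∘ᴿ (pairᶠ ∷ []) ∷ [])) (λ { (_ ∷ _ ∷ []) → refl })

-- Digit 2n of the row of `q` will be `2 + pair (q n) 0`; removing the offset 2 and taking `hd`
-- yields `q n`.
recover : 𝔹 → 𝔹
recover r n = hd (r (2 * n) ∸ 2)

recover-modulus : HasModulus ⌊_/2⌋ recover
recover-modulus k r≡r′ m m< = cong (λ x → hd (x ∸ 2)) (r≡r′ (2 * m) (<half⇒double< k m<))

recover-computableWord : ComputableWord (truncate ⌊_/2⌋ recover)
recover-computableWord = program recoverᶠ , λ w →
  subst (program recoverᶠ [ code w ∷ [] ]⇓_) (cong code (simplify w))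
    (correct recoverᶠ (code w ∷ []))
  where
    recoverᶠ : RecFun 1
    recoverᶠ = graph≡ (λ { (c ∷ []) → code (applyUpTo (recover (at c)) ⌊ len c /2⌋) })
      (applyUpToᶠ
         (graph≡ (λ { (n ∷ c ∷ []) → recover (at c) n })
           (hdᶠ ∘ᴿ (monusᶠ ∘ᴿ (atᶠ ∘ᴿ (var 1F ∷ mulᶠ ∘ᴿ (twoᶠ ∷ var 0F ∷ []) ∷ []) ∷ twoᶠ ∷ []) ∷ []))
           (λ { (_ ∷ _ ∷ []) → refl }))
       ∘ᴿ (halfᶠ ∘ᴿ (lenᶠ ∷ []) ∷ var 0F ∷ []))
      (λ { (_ ∷ []) → refl })

    simplify : ∀ w → applyUpTo (recover (at (code w))) ⌊ len (code w) /2⌋ ≡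
                     truncate ⌊_/2⌋ recover w
    simplify w rewrite len-code w =
      applyUpTo-cong ⌊ length w /2⌋ (λ n → cong (λ x → hd (x ∸ 2)) (at-code w (2 * n)))

recoverFunc : Func Baire Baire
recoverFunc = record { to = recover ; cong = λ r≗r′ n → cong (λ x → hd (x ∸ 2)) (r≗r′ (2 * n)) }

recover-computable : Computable (total recoverFunc)
recover-computable = total-computable recoverFunc {⌊_/2⌋} recover-modulus ⌊n/2⌋-mono half-unbounded
  recover-computableWord

-- The first component stays a number, since the digits of a row carry an index or a value of `q`
-- there rather than the code of a given word.
entry-injective : ∀ {u v x w} → 2 + pair x (code w) ≡ entry u v → x ≡ code u × w ≡ v
entry-injective {u} {v} {x} {w} eq
  with pair-injective {x} {code w} {code u} {code v} (suc-injective (suc-injective eq))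
... | x≡u , w≡v = x≡u , code-injective w v w≡v

-- The fixed point

module _ (φ : Word → Word) where

  -- Even digits store q; since they list only the empty word, they act as dummies.
  -- at n and len n read n as the code of a word.
  row : 𝔹 → 𝔹 → 𝔹
  row s q = ⟨ (λ n → 2 + pair (q n) 0)
            , (λ n → 2 + pair n (code (φ (applyUpTo ⟨ s , ⟨ q , at n ⟩ ⟩ (len n))))) ⟩

  recover-row : ∀ s q → recover (row s q) ≗ q
  recover-row s q n =
    trans (cong (λ x → hd (x ∸ 2)) (⟨⟩-even n)) (hd-pair (q n) 0)

  -- An odd digit built from index `n` reads `s` only below `len n`, and `len n ≤ n ≤ m`. This
  -- strict bound makes the recursion for `name` well founded. An even digit reads `q n` itself,
  -- hence the weak bound for `q`.
  row-cong-≤ : ∀ {s s′ q q′} m → (∀ i → i < m → s i ≡ s′ i) → (∀ i → i ≤ m → q i ≡ q′ i) →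
               row s q m ≡ row s′ q′ m
  row-cong-≤ m s≡s′ q≡q′ = ⟨⟩-cong-≤ m
    (λ n n≤m → cong (λ a → 2 + pair a 0) (q≡q′ n n≤m))
    (λ n n≤m → cong (λ w → 2 + pair n (code (φ w)))
      (applyUpTo-cong-< (len n) (λ i i<len →
        let i<m = <-≤-trans i<len (≤-trans (len≤ n) n≤m) in
        ⟨⟩-cong-≤ i (λ j j≤i → s≡s′ j (≤-<-trans j≤i i<m))
          (λ j j≤i → ⟨⟩-cong-≤ j
            (λ k k≤j → q≡q′ k (<⇒≤ (≤-<-trans (≤-trans k≤j j≤i) i<m)))
            (λ _ _ → refl)))))

  row-modulus : ∀ s → HasModulus (λ n → n) (row s)
  row-modulus s k q≡q′ m m<k =
    row-cong-≤ m (λ _ _ → refl) (λ i i≤m → q≡q′ i (≤-<-trans i≤m m<k))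

  -- h codes a finite prefix of a sequence with the last value first.
  unreverse : ℕ → 𝔹
  unreverse h i = at h (len h ∸ suc i)

  -- The output to be listed for the input word coded by `c`, computed from numbers alone: `h`
  -- supplies the values of the name found so far, `at c` the input padded with zeros.
  rowWord : ℕ → ℕ → Word
  rowWord h c = applyUpTo (row (unreverse h) (at c)) (len c)

  -- Course-of-values recursion as a primitive recursion on codes. The latest value comes first
  -- because `pair` adds in front; the new digit is spelled out because `name` is defined from
  -- `history`.
  history : ℕ → ℕ
  history zero    = 0
  history (suc n) = pair (2 + pair n (code (rowWord (history n) n))) (history n)

  -- On codes, unreverse (history n) can be replaced by name itself (rowWord-history),
  -- so name is a name of row name.
  name : 𝔹
  name n = 2 + pair n (code (rowWord (history n) n))

  history-code : ∀ n → history n ≡ code (applyDownFrom name n)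
  history-code zero    = refl
  history-code (suc n) = cong (pair (name n)) (history-code n)

  unreverse-history : ∀ n i → i < n → unreverse (history n) i ≡ name i
  unreverse-history n i i<n rewrite history-code n | len-code (applyDownFrom name n)
    | length-applyDownFrom name n =
    trans (at-code (applyDownFrom name n) (n ∸ suc i)) (nth-applyDownFrom name n i i<n)

  -- The first `length w` values of a row read the sequence `s` only below `length w ≤ code w`,
  -- where the history already agrees with `name`.
  rowWord-history : ∀ w → rowWord (history (code w)) (code w) ≡ truncate (λ n → n) (row name) w
  rowWord-history w rewrite len-code w =
    applyUpTo-cong-< (length w) (λ m m<len → row-cong-≤ m
      (λ i i<m → unreverse-history (code w) i
        (<-≤-trans (<-trans i<m m<len) (length≤code w)))
      (λ i _ → at-code w i))

  name-code : ∀ w → name (code w) ≡ entry w (truncate (λ n → n) (row name) w)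
  name-code w = cong (λ v → 2 + pair (code w) (code v)) (rowWord-history w)

  rowFunc : Func Baire Baire
  rowFunc = record
    { to   = row name
    ; cong = λ q≗q′ m → row-cong-≤ {name} {name} m (λ _ _ → refl) (λ i _ → q≗q′ i)
    }

  -- Position `i` of `name` carries `i` itself as input code, which forces `i ≡ code u`. The words
  -- listed for `p` are therefore truncations on prefixes of `p`: they are prefixes of `row name p`
  -- and arbitrarily long.
  name-listed : ∀ p → IsSup (Listed name p) (row name p)
  name-listed p =
    (λ v (u , u⊏p , i , eq) → bound u⊏p (entry-injective {u} {v} {i} {rowWord (history i) i} eq)) ,
    (λ n → let k , n≤ = truncate-long {λ n → n} (row-modulus name) id-unbounded p n
               u      = applyUpTo p k
           in truncate (λ n → n) (row name) u , (u , applyUpTo-⊏ p k , code u , name-code u) , n≤)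
    where
      bound : ∀ {u v i} → u ⊏ p → i ≡ code u × rowWord (history i) i ≡ v → v ⊏ row name p
      bound {u} u⊏p (refl , refl) = subst (_⊏ row name p) (sym (rowWord-history u))
        (truncate-⊏ {λ n → n} (row-modulus name) u⊏p)

  -- The fixed-point equation. Since `U name` has the value `row name p` at every `p`, uniqueness of
  -- suprema gives the converse direction.
  total-row≐U-name : total rowFunc ≐ U name
  total-row≐U-name p r = mk⇔
    (λ e → IsSup-resp (λ l → l) (λ l → l) e (name-listed p))
    (λ sup → IsSup-unique (name-listed p) sup)

  -- For a prefix `u` of `p`, padding `u` does not affect the first `length u` values of the nested
  -- pair. So the odd digits list for `p` precisely the values of `φ` on prefixes of
  -- `⟨ s , ⟨ q , p ⟩ ⟩`.
  row-listed : ∀ s q p {y} → IsSup (Image φ ⟨ s , ⟨ q , p ⟩ ⟩) y → IsSup (Listed (row s q) p) y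
  row-listed s q p {y} (ub , long) = bound , unbounded
    where
      input : ℕ → Word
      input n = applyUpTo ⟨ s , ⟨ q , at n ⟩ ⟩ (len n)

      input-⊏ : ∀ {u} → u ⊏ p → input (code u) ≡ applyUpTo ⟨ s , ⟨ q , p ⟩ ⟩ (length u)
      input-⊏ {u} u⊏p rewrite len-code u = applyUpTo-cong-< (length u) (λ i i<len →
        ⟨⟩-cong-≤ i (λ _ _ → refl) (λ j j≤i → ⟨⟩-cong-≤ j (λ _ _ → refl)
          (λ k k≤j → trans (at-code u k)
            (⊏⇒nth≡ u⊏p k (≤-<-trans (≤-trans k≤j j≤i) i<len)))))

      bound : ∀ v → Listed (row s q) p v → v ⊏ y
      bound v (u , u⊏p , i , eq) with ⟨⟩-value i
      -- An even digit lists the empty word, a prefix of every sequence.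
      ... | inj₁ even with entry-injective {u} {v} {q ⌊ i /2⌋} {[]} (trans (sym even) eq)
      ...   | _ , refl = refl
      bound v (u , u⊏p , i , eq) | inj₂ odd
        with entry-injective {u} {v} {_} {φ (input ⌊ i /2⌋)} (trans (sym odd) eq)
      ... | n≡u , refl = ub _ (input ⌊ i /2⌋ ,
        subst (λ n → input n ⊏ _) (sym n≡u)
          (subst (_⊏ _) (sym (input-⊏ u⊏p)) (applyUpTo-⊏ _ (length u))) , refl)

      unbounded : ∀ n → ∃[ v ] Listed (row s q) p v × n ≤ length v
      unbounded n with long n
      -- The prefix `u` of `p` with the same length as `w` yields `w` as input of `φ`; its entry is
      -- the odd digit with index `code u`.
      ... | _ , (w , w⊏ , refl) , n≤ = φ w ,
        (u , applyUpTo-⊏ p (length w) , 1 + 2 * code u ,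
         trans (⟨⟩-odd (code u) {λ n → 2 + pair (q n) 0})
               (cong (λ v → entry u (φ v)) input≡w)) , n≤
        where
          u : Word
          u = applyUpTo p (length w)

          input≡w : input (code u) ≡ w
          input≡w = trans (input-⊏ (applyUpTo-⊏ p (length w)))
            (trans (cong (applyUpTo _) (length-applyUpTo p (length w))) w⊏)

  -- Computability of the fixed point and of its inverse

  module _ (φ-computable : ComputableWord φ) where

    -- The program for `φ` is specified on codes of words, so `φ` is composed with a tabulation,
    -- whose value is visibly such a code.
    φᶠ : ∀ {n} → RecFun (1 + n) → RecFun (1 + n)
    φᶠ {n} g = record
      { ⟦_⟧     = λ { (l ∷ xs) → code (φ (applyUpTo (λ i → ⟦ g ⟧ (i ∷ xs)) l)) }
      ; program = comp (proj₁ φ-computable) (program (applyUpToᶠ g) ∷ [])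
      ; correct = λ { (l ∷ xs) →
          ⇓-comp (correct (applyUpToᶠ g) (l ∷ xs) ∷ []) (proj₂ φ-computable _) }
      }

    unreverseᶠ : RecFun 2
    unreverseᶠ = graph≡ (λ { (h ∷ i ∷ []) → unreverse h i })
      (atᶠ ∘ᴿ (var 0F ∷ monusᶠ ∘ᴿ (lenᶠ ∘ᴿ (var 0F ∷ []) ∷ sucᶠ ∘ᴿ (var 1F ∷ []) ∷ []) ∷ []))
      (λ { (_ ∷ _ ∷ []) → refl })

    rowᶠ : RecFun 3
    rowᶠ = graph≡ (λ { (m ∷ h ∷ c ∷ []) → row (unreverse h) (at c) m })
      (interleaveᶠ
        (digitᶠ ∘ᴿ (atᶠ ∘ᴿ (var 2F ∷ var 0F ∷ []) ∷ zeroᶠ ∷ []))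
        (digitᶠ ∘ᴿ (var 0F ∷ φᶠ inputᶠ ∘ᴿ (lenᶠ ∘ᴿ (var 0F ∷ []) ∷ var 0F ∷ var 1F ∷ var 2F ∷ []) ∷ [])))
      (λ { (_ ∷ _ ∷ _ ∷ []) → refl })
      where
        inputᶠ : RecFun 4
        inputᶠ = graph≡
          (λ { (i ∷ n ∷ h ∷ c ∷ []) → ⟨ unreverse h , ⟨ at c , at n ⟩ ⟩ i })
          (interleaveᶠ (unreverseᶠ ∘ᴿ (var 2F ∷ var 0F ∷ []))
            (interleaveᶠ (atᶠ ∘ᴿ (var 3F ∷ var 0F ∷ [])) (atᶠ ∘ᴿ (var 1F ∷ var 0F ∷ []))))
          (λ { (_ ∷ _ ∷ _ ∷ _ ∷ []) → refl })

    rowWordᶠ : RecFun 2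
    rowWordᶠ = graph≡ (λ { (h ∷ c ∷ []) → code (rowWord h c) })
      (applyUpToᶠ rowᶠ ∘ᴿ (lenᶠ ∘ᴿ (var 1F ∷ []) ∷ var 0F ∷ var 1F ∷ []))
      (λ { (_ ∷ _ ∷ []) → refl })

    historyᶠ : RecFun 1
    historyᶠ = primrec (λ { (n ∷ []) → history n }) zeroᶠ
      (pairᶠ ∘ᴿ (digitᶠ ∘ᴿ (var 0F ∷ rowWordᶠ ∘ᴿ (var 1F ∷ var 0F ∷ []) ∷ []) ∷ var 1F ∷ []))
      (λ { [] → refl }) (λ { _ [] → refl })

    row-computableWord : ComputableWord (truncate (λ n → n) (row name))
    row-computableWord = program finiteRowᶠ , λ w →
      subst (program finiteRowᶠ [ code w ∷ [] ]⇓_) (cong code (rowWord-history w))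
        (correct finiteRowᶠ (code w ∷ []))
      where
        finiteRowᶠ : RecFun 1
        finiteRowᶠ = graph≡ (λ { (c ∷ []) → code (rowWord (history c) c) })
          (rowWordᶠ ∘ᴿ (historyᶠ ∷ var 0F ∷ [])) (λ { (_ ∷ []) → refl })

    row-injection : IsComputableInjection (total rowFunc)
    row-injection = record
      { computable = total-computable rowFunc {λ n → n} (row-modulus name) (λ m≤n → m≤n)
                       id-unbounded
                       row-computableWord
      ; injective  = λ {p} {p′} p↦r p′↦r n →
                       trans (sym (inverse {p} p↦r n)) (inverse {p′} p′↦r n)
      ; inverse    = total recoverFunc , recover-computable , λ {p} → inverse {p}
      }
      where
        inverse : ∀ {p r} → row name p ≗ r → recover r ≗ p
        inverse {p} {r} e n =
          trans (sym (Func.cong recoverFunc e n)) (recover-row name p n)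

theorem6 : ∀ {ℓ} (f : PFunctional ℓ) → ComputableFunctional f →
    Σ[ R ∈ Func Baire Baire ]
    IsComputableInjection (total R) ×
    (∀ q p y → f ∋ total R ∣ ⟨ q , p ⟩ ↦ y → U (Func.to R q) ∋ p ↦ y)
theorem6 f (F , (φ , _ , φ-computable , φ-approximates) , F-realizes) =
  rowFunc φ , row-injection φ φ-computable , λ q p y fRqp↦y →
    -- By `total-row≐U-name`, `f` may be given `U name` in place of the function itself. The
    -- realizer then applies to the name `name`, and its value is what `row name q` lists for `p`.
    row-listed φ (name φ) q p (φ-approximates _ y (F-realizes (name φ) ⟨ q , p ⟩ y
      (PFunctional.resp f (total-row≐U-name φ) (λ _ → refl) (λ _ → refl) fRqp↦y)))
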